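{- The sets $\mathcal{Y}_3=\{S_3,C_2,Z_2\}$, $\mathcal{N}_{3,1}=\{L_2\}$, $\mathcal{N}_{3,2}=\{S_3,Z_2\}$, $\mathcal{N}_{3,3}=\{S_3,C_2,P_{5,10}\}$ and $\mathcal{N}_{3,4}=\{S_4,C_2,Z_2\}$ form a characterizing collection of winners and losers for size $3$ teams; that is, $\mathcal{Y}_3$ is a winning team, each $\mathcal{N}_{3,i}$ ($1\le i\le4$) is a losing team, and for every team $\mathcal{F}$ with exactly $3$ elements, either $\mathcal{F}\preceq\mathcal{Y}_3$ or $\mathcal{N}_{3,i}\preceq\mathcal{F}$ for some $i\in\{1,2,3,4\}$. (Consequently a team of size $3$ is a winner if and only if it is simpler than $\mathcal{Y}_3$.)
   Context: Board and polyominoes. The cells are the translates of the unit square $[0,1]\times[0,1]$ by vectors of $\mathbf{Z}^2$; identify a cell with the vector in $\mathbf{Z}^2$. Two cells are adjacent if they share an edge. A polyomino is a nonempty (finite or infinite) set of cells that is connected through adjacent cells, considered up to congruence (translations, rotations, reflections of the board). Game. Two players, maker (moving first) and breaker, alternately mark previously unmarked cells of the infinite board: in each turn the maker marks 1 cell and the breaker marks 2 cells. For a set $\mathcal{S}$ of finite polyominoes, the maker wins if after finitely many moves he has marked all the cells of a set congruent to some element of $\mathcal{S}$; the breaker wins if she prevents this. $\mathcal{S}$ is a winner (winning) if the maker has a winning strategy. Ancestors. $P\sqsubseteq Q$ ($P$ is an ancestor of $Q$) means that some congruent copy of $P$ is a subset of $Q$. A team is a set of polyominoes no element of which is an ancestor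 of another element; its size is its number of elements. Unbounded sets. A set of polyominoes is unbounded if it contains an infinite polyomino. If $\mathcal{T}$ is unbounded and $F_T$ is a finite ancestor of $T$ for each $T\in\mathcal{T}$, then $\{F_T\mid T\in\mathcal{T}\}$ is a bounded restriction of $\mathcal{T}$. An unbounded set is a winner if each of its bounded restrictions is a winner. A set that is not a winner is a loser (losing). Simpler. $\mathcal{S}\preceq\mathcal{T}$ ($\mathcal{S}$ is simpler than $\mathcal{T}$) means that for all $Q\in\mathcal{T}$ there is $P\in\mathcal{S}$ with $P\sqsubseteq Q$. Particular polyominoes (up to congruence): $S_n=\{(0,0),\dots,(n-1,0)\}$; $L_2=\{(0,0),(1,0),(0,1)\}$; $C_2=\{(0,0),(1,0),(0,1),(1,1)\}$; $Z_2=\{(0,0),(1,0),(0,1),(1,-1)\}$; $P_{5,10}=\{(0,0),(1,0),(1,1),(2,1),(2,2)\}$ (the staircase polyomino with five cells). -}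

module Defs where

open import Data.Bool.Base using (Bool; if_then_else_)
open import Data.Fin.Base using (Fin; toℕ)
open import Data.Integer.Base using (ℤ; +_; -[1+_]; -_; ∣_∣; _+_; _-_)
import Data.Integer.Properties as ℤ
open import Data.List.Base as List using (List; []; _∷_)
open import Data.List.Membership.Propositional using (find)
  renaming (_∈_ to _∈ₗ_; _∉_ to _∉ₗ_)
open import Data.List.Relation.Unary.Any using (Any; any?; here; there)
open import Data.Nat.Base as ℕ using (ℕ; zero; suc)
open import Data.Nat.GeneralisedArithmetic using (fold)
import Data.Nat.Properties as ℕ
open import Data.Product.Base using (∃; _×_; _,_; proj₁)
open import Data.Unit.Base using (⊤; tt)
import Data.Vec.Functional as Vector
open Vector using (Vector)
open import Level using (0ℓ)
open import Relation.Binary.Construct.Closure.ReflexiveTransitive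
  using (Star; ε; _◅_; _◅◅_; reverse)
open import Relation.Binary.PropositionalEquality
  using (_≡_; _≢_; refl; trans; cong₂)
open import Relation.Nullary using (¬_; Dec; yes; _×-dec_)
open import Relation.Nullary.Decidable using (True; toWitness)
open import Relation.Unary using (Pred; _∈_; _≐_; Satisfiable)

------------------------------------------------------------------------
-- The board

Cell : Set
Cell = ℤ × ℤ

-- Two unit squares share an edge iff their corners are at ℓ¹-distance 1.
Adjacent : Cell → Cell → Set
Adjacent (x , y) (x′ , y′) = ∣ x - x′ ∣ ℕ.+ ∣ y - y′ ∣ ≡ 1

quarterTurn mirror : Cell → Cell
quarterTurn (x , y) = - y , x
mirror      (x , y) = - x , y

translate : Cell → Cell → Cell
translate (a , b) (x , y) = a + x , b + y

-- Every composite of translations, rotations and reflections of the board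
-- can be written as an optional reflection, then some quarter turns, then a
-- translation.
record Congruence : Set where
  field
    mirrored : Bool
    turns    : Fin 4
    shift    : Cell

infixr 20 _·_

_·_ : Congruence → Cell → Cell
g · c = translate shift (fold (if mirrored then mirror c else c) quarterTurn (toℕ turns))
  where open Congruence g

infix 4 _↪_ _⊑_ _≼_

-- Some congruent copy of A is a subset of B.
_↪_ : Pred Cell 0ℓ → Pred Cell 0ℓ → Set
A ↪ B = ∃ λ (g : Congruence) → ∀ {c} → c ∈ A → g · c ∈ B

------------------------------------------------------------------------
-- Polyominoes

AdjacentIn : Pred Cell 0ℓ → Cell → Cell → Set
AdjacentIn A c d = c ∈ A × d ∈ A × Adjacent c d

Connected : Pred Cell 0ℓ → Set
Connected A = ∀ {c d} → c ∈ A → d ∈ A → Star (AdjacentIn A) c d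

-- A polyomino is given by one of its representatives on the board, which may
-- be infinite; every notion below is invariant under congruence.
record Polyomino : Set₁ where
  field
    cells     : Pred Cell 0ℓ
    nonempty  : Satisfiable cells
    connected : Connected cells

open Polyomino public

Finite Infinite : Polyomino → Set
Finite P   = ∃ λ (cs : List Cell) → cells P ≐ (_∈ₗ cs)
Infinite P = ¬ Finite P

_⊑_ : Polyomino → Polyomino → Set
P ⊑ Q = cells P ↪ cells Q

------------------------------------------------------------------------
-- Sets of polyominoes, as indexed families

private
  variable
    I J : Set

-- The condition also makes the members pairwise non-congruent, so a team
-- indexed by Fin n has exactly n elements.
IsTeam : (I → Polyomino) → Set
IsTeam F = ∀ i j → i ≢ j → ¬ (F i ⊑ F j)

_≼_ : (I → Polyomino) → (J → Polyomino) → Set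
S ≼ T = ∀ j → ∃ λ i → S i ⊑ T j

Bounded Unbounded : (I → Polyomino) → Set
Bounded F   = ∀ i → Finite (F i)
Unbounded F = ∃ λ i → Infinite (F i)

_IsBoundedRestrictionOf_ : (I → Polyomino) → (I → Polyomino) → Set
G IsBoundedRestrictionOf F = ∀ i → Finite (G i) × G i ⊑ F i

------------------------------------------------------------------------
-- The game

-- One move of the maker followed by one move of the breaker.
record Round : Set where
  constructor round
  field
    maker breaker₁ breaker₂ : Cell

open Round public

-- The completed rounds, most recent first.
History : Set
History = List Round

makerMarks : History → List Cell
makerMarks = List.map maker

marks : History → List Cell
marks = List.concatMap λ r → breaker₂ r ∷ breaker₁ r ∷ maker r ∷ []

past : (ℕ → Round) → ℕ → History
past r zero    = []
past r (suc n) = r n ∷ past r n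

MakerStrategy : Set
MakerStrategy = (h : History) → ∃ λ c → c ∉ₗ marks h

_Follows_ : (ℕ → Round) → MakerStrategy → Set
r Follows σ = ∀ n → maker (r n) ≡ proj₁ (σ (past r n))

BreakerLegal : (ℕ → Round) → Set
BreakerLegal r = ∀ n →
  breaker₁ (r n) ∉ₗ maker (r n) ∷ marks (past r n) ×
  breaker₂ (r n) ∉ₗ breaker₁ (r n) ∷ maker (r n) ∷ marks (past r n)

-- Play is continued for ever; the maker has won if at some stage his marks
-- contain a copy of a member of F. As the board is infinite, a won game can
-- always be continued.
MakerWins : (I → Polyomino) → (ℕ → Round) → Set
MakerWins F r = ∃ λ n → ∃ λ i → cells (F i) ↪ (_∈ₗ makerMarks (past r n))

HasWinningStrategy : (I → Polyomino) → Set
HasWinningStrategy F = ∃ λ (σ : MakerStrategy) →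
  ∀ r → r Follows σ → BreakerLegal r → MakerWins F r

data Winner {I : Set} (F : I → Polyomino) : Set₁ where
  bounded   : Bounded F → HasWinningStrategy F → Winner F
  unbounded : Unbounded F →
              (∀ G → G IsBoundedRestrictionOf F → HasWinningStrategy G) →
              Winner F

Loser : (I → Polyomino) → Set₁
Loser F = ¬ Winner F

------------------------------------------------------------------------
-- Finite polyominoes from lists of cells

-- Each cell of the second list is adjacent to a cell of the first list or to
-- an earlier cell of the second list.
Grows : List Cell → List Cell → Set
Grows acc []       = ⊤
Grows acc (c ∷ cs) = Any (Adjacent c) acc × Grows (c ∷ acc) cs

grows? : ∀ acc cs → Dec (Grows acc cs)
grows? acc []       = yes tt
grows? acc (c ∷ cs) = any? (λ _ → _ ℕ.≟ 1) acc ×-dec grows? (c ∷ acc) cs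

private
  Adjacent-sym : ∀ c d → Adjacent c d → Adjacent d c
  Adjacent-sym (x , y) (x′ , y′) =
    trans (cong₂ ℕ._+_ (ℤ.∣i-j∣≡∣j-i∣ x′ x) (ℤ.∣i-j∣≡∣j-i∣ y′ y))

  module _ {A : Pred Cell 0ℓ} {o : Cell} where

    reach : ∀ acc cs → Grows acc cs → (∀ {c} → c ∈ₗ cs → c ∈ A) →
            (∀ {c} → c ∈ₗ acc → c ∈ A × Star (AdjacentIn A) o c) →
            ∀ {c} → c ∈ₗ cs → Star (AdjacentIn A) o c
    reach acc (d ∷ cs) (adj , grows) cs⊆A ok with find adj
    ... | a , a∈ , d~a with ok a∈
    ... | a∈A , o↝a = result
      where
      o↝d = o↝a ◅◅ (a∈A , cs⊆A (here refl) , Adjacent-sym d a d~a) ◅ ε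

      ok′ : ∀ {c} → c ∈ₗ d ∷ acc → c ∈ A × Star (AdjacentIn A) o c
      ok′ (here refl) = cs⊆A (here refl) , o↝d
      ok′ (there c∈)  = ok c∈

      result : ∀ {c} → c ∈ₗ d ∷ cs → Star (AdjacentIn A) o c
      result (here refl) = o↝d
      result (there c∈)  = reach (d ∷ acc) cs grows (λ p → cs⊆A (there p)) ok′ c∈

polyomino : ∀ c cs {_ : True (grows? (c ∷ []) cs)} → Polyomino
polyomino o cs {g} = record
  { cells     = _∈ₗ o ∷ cs
  ; nonempty  = o , here refl
  ; connected = λ c∈ d∈ → reverse flip (from-o c∈) ◅◅ from-o d∈
  }
  where
  A : Pred Cell 0ℓ
  A = _∈ₗ o ∷ cs

  flip : ∀ {c d} → AdjacentIn A c d → AdjacentIn A d c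
  flip {c} {d} (c∈ , d∈ , c~d) = d∈ , c∈ , Adjacent-sym c d c~d

  from-o : ∀ {c} → c ∈ A → Star (AdjacentIn A) o c
  from-o (here refl) = ε
  from-o (there c∈)  = reach (o ∷ []) cs (toWitness g) there
    (λ { (here refl) → here refl , ε }) c∈

S₃ S₄ L₂ C₂ Z₂ P₅,₁₀ : Polyomino
S₃    = polyomino (+ 0 , + 0) ((+ 1 , + 0) ∷ (+ 2 , + 0) ∷ [])
S₄    = polyomino (+ 0 , + 0) ((+ 1 , + 0) ∷ (+ 2 , + 0) ∷ (+ 3 , + 0) ∷ [])
L₂    = polyomino (+ 0 , + 0) ((+ 1 , + 0) ∷ (+ 0 , + 1) ∷ [])
C₂    = polyomino (+ 0 , + 0) ((+ 1 , + 0) ∷ (+ 0 , + 1) ∷ (+ 1 , + 1) ∷ [])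
Z₂    = polyomino (+ 0 , + 0) ((+ 1 , + 0) ∷ (+ 0 , + 1) ∷ (+ 1 , -[1+ 0 ]) ∷ [])
P₅,₁₀ = polyomino (+ 0 , + 0) ((+ 1 , + 0) ∷ (+ 1 , + 1) ∷ (+ 2 , + 1) ∷ (+ 2 , + 2) ∷ [])

𝒴₃ : Vector Polyomino 3
𝒴₃ = S₃ Vector.∷ C₂ Vector.∷ Z₂ Vector.∷ Vector.[]

𝒩₃,₁ : Vector Polyomino 1
𝒩₃,₁ = L₂ Vector.∷ Vector.[]

𝒩₃,₂ : Vector Polyomino 2
𝒩₃,₂ = S₃ Vector.∷ Z₂ Vector.∷ Vector.[]

𝒩₃,₃ 𝒩₃,₄ : Vector Polyomino 3
𝒩₃,₃ = S₃ Vector.∷ C₂ Vector.∷ P₅,₁₀ Vector.∷ Vector.[]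
𝒩₃,₄ = S₄ Vector.∷ C₂ Vector.∷ Z₂ Vector.∷ Vector.[]

{-# OPTIONS --safe #-}
module Submission where

-- The maker wins 𝒴₃ by always marking some free cell adjacent to his own
-- marks: sets of 1, 2 and 3 cells (other than S₃) have 4, 6 and 7 adjacent
-- cells, while the breaker then owns only 2, 4 and 6 marks, and every
-- connected set of four cells contains S₃, C₂ or Z₂.  For each of the losing
-- teams there is a doubly periodic graph on the board, of degree at most 2,
-- such that every copy of a member contains an edge; the breaker answers a
-- cell by its neighbours in this graph.
--
-- For the classification, a polyomino containing a finite set X of cells
-- either is a copy of X or contains X together with an adjacent cell.  If no
-- 𝒩₃,ᵢ is simpler than F, then some member is free of L₂, and it is the only
-- one since two L₂-free polyominoes are comparable; some other member has
-- neither S₃ nor Z₂ and so is C₂; growing the remaining one out of L₂ leads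
-- to Z₂, and then growing the first one out of S₃ shows that it is S₃.

open import Defs
open import Axiom.ExcludedMiddle using (ExcludedMiddle)
open import Data.Bool.Base using (Bool; true; false; not; if_then_else_)
open import Data.Fin.Base using (Fin; zero; suc; toℕ; fromℕ<)
import Data.Fin.Properties as Fin
open import Data.Integer.Base as ℤ using (ℤ; +_; -[1+_]; -_; ∣_∣; _+_; _-_; _*_)
open import Data.Integer.DivMod using (_%ℕ_; _/ℕ_; n%ℕd<d; a≡a%ℕn+[a/ℕn]*n)
import Data.Integer.Properties as ℤ
open import Algebra.Properties.AbelianGroup ℤ.+-0-abelianGroup
  using (\\-leftDividesʳ; //-rightDividesʳ)
open import Data.Integer.Solver using (module +-*-Solver)
open import Data.List.Base as List
  using (List; []; _∷_; _++_; length; map; filter; deduplicate; concatMap; applyUpTo)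
import Data.List.Membership.DecPropositional as DecMembership
open import Data.List.Membership.Propositional using (lose; find)
  renaming (_∈_ to _∈ₗ_; _∉_ to _∉ₗ_)
open import Data.List.Membership.Propositional.Properties
  using (∈-map⁺; ∈-map⁻; ∈-filter⁺; ∈-concatMap⁺; ∈-deduplicate⁺; ∈-lookup; ∈-++⁻)
open import Data.List.Properties using (length-applyUpTo)
open import Data.List.Relation.Unary.All as All using (All; []; _∷_)
open import Data.List.Relation.Unary.All.Properties using (¬Any⇒All¬)
open import Data.List.Relation.Unary.AllPairs using ([]; _∷_)
open import Data.List.Relation.Unary.Any as Any using (Any; here; there; any?)
open import Data.List.Relation.Unary.Any.Properties using (lookup-index)
import Data.List.Relation.Unary.Unique.DecPropositional as DecUnique
open import Data.List.Relation.Unary.Unique.Propositional using (Unique)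
open import Data.List.Relation.Unary.Unique.Propositional.Properties using (applyUpTo⁺₁)
open import Data.Nat.Base as ℕ using (ℕ; zero; suc; z≤n; s≤s)
open import Data.Nat.GeneralisedArithmetic using (fold)
import Data.Nat.Properties as ℕ
open import Data.Product.Base using (∃; _×_; _,_; proj₁; proj₂)
open import Data.Product.Properties using (≡-dec)
open import Data.Sum.Base as Sum using (_⊎_; inj₁; inj₂; [_,_]′)
open import Data.Vec.Functional using (Vector)
open import Function.Base using (_∘_; id; case_of_)
open import Function.Bundles using (_⇔_; mk⇔)
open import Level using (0ℓ)
open import Relation.Binary.Construct.Closure.ReflexiveTransitive using (Star; ε; _◅_)
open import Relation.Binary.Definitions using (DecidableEquality)
open import Relation.Binary.PropositionalEquality
open import Relation.Nullary using (¬_; Dec; yes; no; contradiction)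
open import Relation.Nullary.Decidable
  using (True; toWitness; from-yes; map′; ¬?; _×-dec_; _⊎-dec_; _→-dec_; decidable-stable)
open import Relation.Unary using (Pred; _∈_; _∉_)

_≟_ : DecidableEquality Cell
_≟_ = ≡-dec ℤ._≟_ ℤ._≟_

open DecMembership _≟_ using (_∈?_)
open DecUnique _≟_ using (unique?)

-- Congruences

orient : Bool → Fin 4 → Cell → Cell
orient m t c = fold (if m then mirror c else c) quarterTurn (toℕ t)

-- A composite of congruences has to be brought back to the normal form of `Congruence`. This is
-- done one generator at a time, so the target is a plain function, compared pointwise.
Realizable : (Cell → Cell) → Set
Realizable f = ∃ λ (g : Congruence) → ∀ c → g · c ≡ f c

translate-realizable : ∀ s {f} → Realizable f → Realizable (translate s ∘ f)
translate-realizable (a , b) (g , g≡f) =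
  record { mirrored = mirrored ; turns = turns ; shift = translate (a , b) shift } ,
  λ c → trans (cong₂ _,_ (ℤ.+-assoc a _ _) (ℤ.+-assoc b _ _)) (cong (translate (a , b)) (g≡f c))
  where open Congruence g

quarterTurn-translate : ∀ s c → quarterTurn (translate s c) ≡ translate (quarterTurn s) (quarterTurn c)
quarterTurn-translate (a , b) (x , y) = cong (_, a + x) (ℤ.neg-distrib-+ b y)

mirror-translate : ∀ s c → mirror (translate s c) ≡ translate (mirror s) (mirror c)
mirror-translate (a , b) (x , y) = cong (_, b + y) (ℤ.neg-distrib-+ a x)

next : Fin 4 → Fin 4
next zero                   = suc zero
next (suc zero)             = suc (suc zero)
next (suc (suc zero))       = suc (suc (suc zero))
next (suc (suc (suc zero))) = zero

quarterTurn-orient : ∀ m t c → orient m (next t) c ≡ quarterTurn (orient m t c)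
quarterTurn-orient m zero                   c = refl
quarterTurn-orient m (suc zero)             c = refl
quarterTurn-orient m (suc (suc zero))       c = refl
quarterTurn-orient m (suc (suc (suc zero))) c =
  sym (cong₂ _,_ (ℤ.neg-involutive _) (ℤ.neg-involutive _))

quarterTurn-realizable : ∀ {f} → Realizable f → Realizable (quarterTurn ∘ f)
quarterTurn-realizable (g , g≡f) =
  record { mirrored = mirrored ; turns = next turns ; shift = quarterTurn shift } ,
  λ c → begin
    translate (quarterTurn shift) (orient mirrored (next turns) c)
      ≡⟨ cong (translate (quarterTurn shift)) (quarterTurn-orient mirrored turns c) ⟩
    translate (quarterTurn shift) (quarterTurn (orient mirrored turns c))
      ≡⟨ quarterTurn-translate shift _ ⟨
    quarterTurn (g · c)
      ≡⟨ cong quarterTurn (g≡f c) ⟩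
    _ ∎
  where open Congruence g; open ≡-Reasoning

-- Negation modulo 4: a reflection moved past `t` quarter turns reverses their direction.
opposite : Fin 4 → Fin 4
opposite zero                   = zero
opposite (suc zero)             = suc (suc (suc zero))
opposite (suc (suc zero))       = suc (suc zero)
opposite (suc (suc (suc zero))) = suc zero

mirror-orient : ∀ m t c → orient (not m) (opposite t) c ≡ mirror (orient m t c)
mirror-orient false zero                   (x , y) = refl
mirror-orient false (suc zero)             (x , y) rewrite ℤ.neg-involutive x | ℤ.neg-involutive y = refl
mirror-orient false (suc (suc zero))       (x , y) rewrite ℤ.neg-involutive x = refl
mirror-orient false (suc (suc (suc zero))) (x , y) rewrite ℤ.neg-involutive y = refl
mirror-orient true  zero                   (x , y) rewrite ℤ.neg-involutive x = refl
mirror-orient true  (suc zero)             (x , y) = refl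
mirror-orient true  (suc (suc zero))       (x , y) rewrite ℤ.neg-involutive x = refl
mirror-orient true  (suc (suc (suc zero))) (x , y) rewrite ℤ.neg-involutive x | ℤ.neg-involutive y = refl

mirror-realizable : ∀ {f} → Realizable f → Realizable (mirror ∘ f)
mirror-realizable (g , g≡f) =
  record { mirrored = not mirrored ; turns = opposite turns ; shift = mirror shift } ,
  λ c → begin
    translate (mirror shift) (orient (not mirrored) (opposite turns) c)
      ≡⟨ cong (translate (mirror shift)) (mirror-orient mirrored turns c) ⟩
    translate (mirror shift) (mirror (orient mirrored turns c))
      ≡⟨ mirror-translate shift _ ⟨
    mirror (g · c)
      ≡⟨ cong mirror (g≡f c) ⟩
    _ ∎
  where open Congruence g; open ≡-Reasoning

turns-realizable : ∀ n {f} → Realizable f → Realizable (λ c → fold (f c) quarterTurn n)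
turns-realizable zero    = id
turns-realizable (suc n) = quarterTurn-realizable ∘ turns-realizable n

orient-realizable : ∀ m t {f} → Realizable f → Realizable (orient m t ∘ f)
orient-realizable false t = turns-realizable (toℕ t)
orient-realizable true  t = turns-realizable (toℕ t) ∘ mirror-realizable

identity : Realizable id
identity = record { mirrored = false ; turns = zero ; shift = + 0 , + 0 } ,
  λ (x , y) → cong₂ _,_ (ℤ.+-identityˡ x) (ℤ.+-identityˡ y)

compose : ∀ g h → Realizable (λ c → g · (h · c))
compose g h = translate-realizable shift (orient-realizable mirrored turns (h , λ _ → refl))
  where open Congruence g

orient-inverse : ∀ m t → ∃ λ m′ → ∃ λ t′ → ∀ c → orient m′ t′ (orient m t c) ≡ c
orient-inverse false t = false , opposite t , λ (x , y) → lemma t x y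
  where
  lemma : ∀ t x y → orient false (opposite t) (orient false t (x , y)) ≡ (x , y)
  lemma zero                   x y = refl
  lemma (suc zero)             x y rewrite ℤ.neg-involutive x | ℤ.neg-involutive y = refl
  lemma (suc (suc zero))       x y rewrite ℤ.neg-involutive x | ℤ.neg-involutive y = refl
  lemma (suc (suc (suc zero))) x y rewrite ℤ.neg-involutive x | ℤ.neg-involutive y = refl
-- A reflection followed by quarter turns is again a reflection in a line, hence an involution.
orient-inverse true t = true , t , λ (x , y) → lemma t x y
  where
  lemma : ∀ t x y → orient true t (orient true t (x , y)) ≡ (x , y)
  lemma zero                   x y rewrite ℤ.neg-involutive x = refl
  lemma (suc zero)             x y rewrite ℤ.neg-involutive x | ℤ.neg-involutive y = refl
  lemma (suc (suc zero))       x y rewrite ℤ.neg-involutive x | ℤ.neg-involutive x | ℤ.neg-involutive y = refl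
  lemma (suc (suc (suc zero))) x y
    rewrite ℤ.neg-involutive x | ℤ.neg-involutive x
          | ℤ.neg-involutive y | ℤ.neg-involutive y = refl

negate : Cell → Cell
negate (x , y) = - x , - y

translate-cancelˡ : ∀ s c → translate (negate s) (translate s c) ≡ c
translate-cancelˡ (a , b) (x , y) = cong₂ _,_ (\\-leftDividesʳ a x) (\\-leftDividesʳ b y)

translate-cancelʳ : ∀ s c → translate (translate s c) (negate c) ≡ s
translate-cancelʳ (a , b) (x , y) = cong₂ _,_ (//-rightDividesʳ x a) (//-rightDividesʳ y b)

inverse : ∀ g → ∃ λ h → ∀ c → h · (g · c) ≡ c
inverse g =
  let m′ , t′ , cancels = orient-inverse mirrored turns
      h , h≡ = orient-realizable m′ t′ (translate-realizable (negate shift) identity)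
  in h , λ c → trans (h≡ (g · c))
       (trans (cong (orient m′ t′) (translate-cancelˡ shift _)) (cancels c))
  where open Congruence g

-- Applied to a left inverse `h` of `g`, it strips `h` from `h · (g · (h · v)) ≡ h · v`; this is how
-- `h` is seen to be a right inverse as well.
·-injective : ∀ g {c d} → g · c ≡ g · d → c ≡ d
·-injective g {c} {d} eq = let h , h∘g = inverse g in
  trans (sym (h∘g c)) (trans (cong (h ·_) eq) (h∘g d))

↪-trans : ∀ {A B C : Pred Cell 0ℓ} → A ↪ B → B ↪ C → A ↪ C
↪-trans {C = C} (g , A⊆B) (h , B⊆C) = let k , k≡ = compose h g in
  k , λ {c} c∈A → subst C (sym (k≡ c)) (B⊆C (A⊆B c∈A))

-- Embeddings of finite sets of cells

-- An orientation and the image of one cell determine a congruence, so only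
-- finitely many of them have to be tried.
place : Bool → Fin 4 → Cell → Cell → Congruence
place m t x y = record { mirrored = m ; turns = t ; shift = translate y (negate (orient m t x)) }

place-unique : ∀ g x c → place (Congruence.mirrored g) (Congruence.turns g) x (g · x) · c ≡ g · c
place-unique g x c = cong (λ s → translate s (orient mirrored turns c))
  (translate-cancelʳ shift (orient mirrored turns x))
  where open Congruence g

∃Bool? : {P : Bool → Set} → (∀ b → Dec (P b)) → Dec (∃ P)
∃Bool? P? with P? false | P? true
... | yes p | _     = yes (false , p)
... | no _  | yes p = yes (true , p)
... | no ¬p | no ¬q = no λ { (false , p) → ¬p p ; (true , q) → ¬q q }

embeds? : ∀ xs ys → Dec ((_∈ₗ xs) ↪ (_∈ₗ ys))
embeds? []         ys = yes (proj₁ identity , λ ())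
embeds? xs@(x ∷ _) ys = map′
  (λ (m , t , ok) → let y , _ , inside = find ok in place m t x y , All.lookup inside)
  (λ (g , inside) → let open Congruence g in
     mirrored , turns , lose (inside (here refl))
       (All.tabulate λ {c} c∈ → subst (_∈ₗ ys) (sym (place-unique g x c)) (inside c∈)))
  (∃Bool? λ m → Fin.any? λ t → any? (λ y → All.all? (λ c → place m t x y · c ∈? ys) xs) ys)

-- Growing polyominoes

units : List Cell
units = (+ 1 , + 0) ∷ (-[1+ 0 ] , + 0) ∷ (+ 0 , + 1) ∷ (+ 0 , -[1+ 0 ]) ∷ []

neighbours : Cell → List Cell
neighbours c = map (translate c) units

-- `Adjacent c d` speaks of the difference `c - d`, while `neighbours c` adds the displacement
-- `d - c` to `c`; hence `negate`.
∈-units : ∀ i j → ∣ i ∣ ℕ.+ ∣ j ∣ ≡ 1 → negate (i , j) ∈ₗ units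
∈-units (+ 0)             (+ 1)          _ = there (there (there (here refl)))
∈-units (+ 0)             -[1+ 0 ]       _ = there (there (here refl))
∈-units (+ 1)             (+ 0)          _ = there (here refl)
∈-units (+ 1)             (+ suc _)      ()
∈-units (+ suc (suc _))   _              ()
∈-units -[1+ 0 ]          (+ 0)          _ = here refl
∈-units -[1+ 0 ]          (+ suc _)      ()
∈-units -[1+ 0 ]          -[1+ _ ]       ()
∈-units -[1+ suc _ ]      _              ()

Adjacent⇒∈neighbours : ∀ c d → Adjacent c d → d ∈ₗ neighbours c
Adjacent⇒∈neighbours c@(x , y) d@(x′ , y′) adj =
  subst (_∈ₗ neighbours c) (cong₂ _,_ (back x x′) (back y y′))
    (∈-map⁺ (translate c) (∈-units (x - x′) (y - y′) adj))
  where
  open +-*-Solver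
  back : ∀ i j → i + - (i - j) ≡ j
  back = solve 2 (λ i j → i :+ :- (i :- j) := j) refl

translate-adjacent : ∀ s c d → Adjacent c d → Adjacent (translate s c) (translate s d)
translate-adjacent (a , b) (x , y) (x′ , y′) =
  subst₂ (λ i j → ∣ i ∣ ℕ.+ ∣ j ∣ ≡ 1) (shift a x x′) (shift b y y′)
  where
  open +-*-Solver
  shift : ∀ i j k → j - k ≡ (i + j) - (i + k)
  shift = solve 3 (λ i j k → j :- k := (i :+ j) :- (i :+ k)) refl

∣i-j∣≡∣-i--j∣ : ∀ i j → ∣ i - j ∣ ≡ ∣ - i - - j ∣
∣i-j∣≡∣-i--j∣ i j = trans (sym (ℤ.∣-i∣≡∣i∣ (i - j))) (cong ∣_∣ (ℤ.neg-distrib-+ i (- j)))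

quarterTurn-adjacent : ∀ c d → Adjacent c d → Adjacent (quarterTurn c) (quarterTurn d)
quarterTurn-adjacent (x , y) (x′ , y′) adj = trans (ℕ.+-comm ∣ - y - - y′ ∣ ∣ x - x′ ∣)
  (trans (cong (∣ x - x′ ∣ ℕ.+_) (sym (∣i-j∣≡∣-i--j∣ y y′))) adj)

mirror-adjacent : ∀ c d → Adjacent c d → Adjacent (mirror c) (mirror d)
mirror-adjacent (x , y) (x′ , y′) =
  trans (cong (ℕ._+ ∣ y - y′ ∣) (sym (∣i-j∣≡∣-i--j∣ x x′)))

turns-adjacent : ∀ n c d → Adjacent c d →
                 Adjacent (fold c quarterTurn n) (fold d quarterTurn n)
turns-adjacent zero    c d = id
turns-adjacent (suc n) c d =
  quarterTurn-adjacent (fold c quarterTurn n) (fold d quarterTurn n) ∘ turns-adjacent n c d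

orient-adjacent : ∀ m t c d → Adjacent c d → Adjacent (orient m t c) (orient m t d)
orient-adjacent false t c d = turns-adjacent (toℕ t) c d
orient-adjacent true  t c d = turns-adjacent (toℕ t) _ _ ∘ mirror-adjacent c d

·-adjacent : ∀ g c d → Adjacent c d → Adjacent (g · c) (g · d)
·-adjacent g c d = translate-adjacent shift _ _ ∘ orient-adjacent mirrored turns c d
  where open Congruence g

-- Duplicates are removed because the maker's counting argument needs pairwise distinct cells.
border : List Cell → List Cell
border cs = deduplicate _≟_ (filter (λ c → ¬? (c ∈? cs)) (concatMap neighbours cs))

∈-border : ∀ {cs c d} → c ∈ₗ cs → Adjacent c d → d ∉ₗ cs → d ∈ₗ border cs
∈-border {cs} {c} {d} c∈ c~d d∉ = ∈-deduplicate⁺ _≟_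
  (∈-filter⁺ (λ c → ¬? (c ∈? cs))
    (∈-concatMap⁺ neighbours (lose c∈ (Adjacent⇒∈neighbours c d c~d))) d∉)

-- The finite certificate for one growth step: whichever adjacent cell joins `X`, a copy of some
-- listed set appears. One check serves all polyominoes, finite or infinite.
Extends : List Cell → List (List Cell) → Set
Extends X Ts = All (λ d → Any (λ T → (_∈ₗ T) ↪ (_∈ₗ d ∷ X)) Ts) (border X)

extends? : ∀ X Ts → Dec (Extends X Ts)
extends? X Ts = All.all? (λ d → any? (λ T → embeds? T (d ∷ X)) Ts) (border X)

first-exit : ∀ {A B : Pred Cell 0ℓ} → (∀ c → Dec (c ∈ B)) → ∀ {c d} →
       Star (AdjacentIn A) c d → c ∈ B → d ∉ B →
       ∃ λ u → ∃ λ v → u ∈ B × v ∉ B × v ∈ A × Adjacent u v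
first-exit B? ε c∈B d∉B = contradiction c∈B d∉B
first-exit B? {c} (_◅_ {j = v} (_ , v∈A , c~v) path) c∈B d∉B with B? v
... | yes v∈B = first-exit B? path v∈B d∉B
... | no  v∉B = c , v , c∈B , v∉B , v∈A , c~v

-- Bare lists, on which the decision procedures compute; membership in `s₃`, for instance, is
-- definitionally `cells S₃`.
s₁ s₂ s₃ s₄ l₂ c₂ z₂ p₅,₁₀ : List Cell
s₁    = (+ 0 , + 0) ∷ []
s₂    = (+ 0 , + 0) ∷ (+ 1 , + 0) ∷ []
s₃    = (+ 0 , + 0) ∷ (+ 1 , + 0) ∷ (+ 2 , + 0) ∷ []
s₄    = (+ 0 , + 0) ∷ (+ 1 , + 0) ∷ (+ 2 , + 0) ∷ (+ 3 , + 0) ∷ []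
l₂    = (+ 0 , + 0) ∷ (+ 1 , + 0) ∷ (+ 0 , + 1) ∷ []
c₂    = (+ 0 , + 0) ∷ (+ 1 , + 0) ∷ (+ 0 , + 1) ∷ (+ 1 , + 1) ∷ []
z₂    = (+ 0 , + 0) ∷ (+ 1 , + 0) ∷ (+ 0 , + 1) ∷ (+ 1 , -[1+ 0 ]) ∷ []
p₅,₁₀ = (+ 0 , + 0) ∷ (+ 1 , + 0) ∷ (+ 1 , + 1) ∷ (+ 2 , + 1) ∷ (+ 2 , + 2) ∷ []

-- Polyominoes without L₂

moveTo : Cell → Congruence
moveTo c = record { mirrored = false ; turns = zero ; shift = c }

-- The embedding is `h` after the inverse of `g`: coordinates `z` are read off in the frame of `g`
-- and placed in the frame of `h`.
reframe : ∀ (A B : Pred Cell 0ℓ) g h → (∀ {c} → c ∈ A → ∃ λ z → c ≡ g · z × h · z ∈ B) → A ↪ B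
reframe A B g h maps with inverse g
... | g⁻¹ , g⁻¹∘g with compose h g⁻¹
... | k , k≡ = k , λ {c} c∈A → let z , c≡ , hz∈B = maps c∈A in
  subst (_∈ B) (sym (trans (k≡ c) (cong (h ·_) (trans (cong (g⁻¹ ·_) c≡) (g⁻¹∘g z))))) hz∈B

translate-identityʳ : ∀ c → translate c (+ 0 , + 0) ≡ c
translate-identityʳ (x , y) = cong₂ _,_ (ℤ.+-identityʳ x) (ℤ.+-identityʳ y)

-- The four corners at the origin with one horizontal and one vertical arm; each forbids a step off
-- a horizontal run of cells.
l₂-rightUp : (_∈ₗ l₂) ↪ (_∈ₗ (+ 0 , + 0) ∷ (+ 1 , + 0) ∷ (+ 0 , + 1) ∷ [])
l₂-rightUp = from-yes (embeds? l₂ ((+ 0 , + 0) ∷ (+ 1 , + 0) ∷ (+ 0 , + 1) ∷ []))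

l₂-rightDown : (_∈ₗ l₂) ↪ (_∈ₗ (+ 0 , + 0) ∷ (+ 1 , + 0) ∷ (+ 0 , -[1+ 0 ]) ∷ [])
l₂-rightDown = from-yes (embeds? l₂ ((+ 0 , + 0) ∷ (+ 1 , + 0) ∷ (+ 0 , -[1+ 0 ]) ∷ []))

l₂-leftUp : (_∈ₗ l₂) ↪ (_∈ₗ (+ 0 , + 0) ∷ (-[1+ 0 ] , + 0) ∷ (+ 0 , + 1) ∷ [])
l₂-leftUp = from-yes (embeds? l₂ ((+ 0 , + 0) ∷ (-[1+ 0 ] , + 0) ∷ (+ 0 , + 1) ∷ []))

l₂-leftDown : (_∈ₗ l₂) ↪ (_∈ₗ (+ 0 , + 0) ∷ (-[1+ 0 ] , + 0) ∷ (+ 0 , -[1+ 0 ]) ∷ [])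
l₂-leftDown = from-yes (embeds? l₂ ((+ 0 , + 0) ∷ (-[1+ 0 ] , + 0) ∷ (+ 0 , -[1+ 0 ]) ∷ []))

module Straight (A : Polyomino) (L₂-free : ¬ ((_∈ₗ l₂) ↪ cells A)) where

  corner : ∀ g c u v → (_∈ₗ l₂) ↪ (_∈ₗ (+ 0 , + 0) ∷ u ∷ v ∷ []) →
           g · c ∈ cells A → g · translate c u ∈ cells A → g · translate c v ∉ cells A
  corner g c u v l₂↪ p q r with compose g (moveTo c)
  ... | k , k≡ = L₂-free (↪-trans {_∈ₗ l₂} {_∈ₗ (+ 0 , + 0) ∷ u ∷ v ∷ []} {cells A}
                                  l₂↪ (k , All.lookup inside))
    where
    at : ∀ w → g · translate c w ∈ cells A → k · w ∈ cells A
    at w = subst (_∈ cells A) (sym (k≡ w))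

    inside : All (λ w → k · w ∈ cells A) ((+ 0 , + 0) ∷ u ∷ v ∷ [])
    inside = at (+ 0 , + 0) (subst (λ w → g · w ∈ cells A) (sym (translate-identityʳ c)) p)
           ∷ at u q ∷ at v r ∷ []

  step-back : ∀ g c {u} d → u ≡ g · c → Adjacent u d → ∃ λ e → d ≡ g · e × e ∈ₗ neighbours c
  step-back g c d refl gc~d = let h , h∘g = inverse g in
    h · d , sym (·-injective h (h∘g (h · d))) ,
    Adjacent⇒∈neighbours c (h · d)
      (subst (λ e → Adjacent e (h · d)) (h∘g c) (·-adjacent h (g · c) d gc~d))

  -- `IsRay` fixes an end on one side only, so it covers the finite straight polyominoes together
  -- with the one-sided infinite one.
  IsLine IsRay : Congruence → Set
  IsLine g = (∀ x → g · (x , + 0) ∈ cells A) ×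
             (∀ {c} → c ∈ cells A → ∃ λ x → c ≡ g · (x , + 0))
  IsRay g = ∀ {c} → c ∈ cells A →
    ∃ λ n → c ≡ g · (+ n , + 0) × (∀ {m} → m ℕ.≤ n → g · (+ m , + 0) ∈ cells A)

  module _ (g : Congruence) where

    line : (∀ x → g · (x , + 0) ∈ cells A) → IsLine g
    line full = full , λ c∈A → along (connected A (full (+ 0)) c∈A) (+ 0 , refl)
      where
      next-cell : ∀ x {v} → v ∈ cells A → (∃ λ e → v ≡ g · e × e ∈ₗ neighbours (x , + 0)) →
                  ∃ λ x → v ≡ g · (x , + 0)
      next-cell x v∈A (_ , v≡ , here refl)         = x + + 1 , v≡
      next-cell x v∈A (_ , v≡ , there (here refl)) = x + -[1+ 0 ] , v≡
      next-cell x v∈A (_ , refl , there (there (here refl))) = contradiction v∈A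
        (corner g (x , + 0) (+ 1 , + 0) (+ 0 , + 1) l₂-rightUp (full x) (full (x + + 1)))
      next-cell x v∈A (_ , refl , there (there (there (here refl)))) = contradiction v∈A
        (corner g (x , + 0) (+ 1 , + 0) (+ 0 , -[1+ 0 ]) l₂-rightDown (full x) (full (x + + 1)))

      along : ∀ {c d} → Star (AdjacentIn (cells A)) c d →
              (∃ λ x → c ≡ g · (x , + 0)) → ∃ λ x → d ≡ g · (x , + 0)
      along ε p = p
      along (_◅_ {j = v} (_ , v∈A , u~v) path) (x , u≡) =
        along path (next-cell x v∈A (step-back g (x , + 0) v u≡ u~v))

    ray : g · (+ 0 , + 0) ∈ cells A → g · (+ 1 , + 0) ∈ cells A →
          g · (-[1+ 0 ] , + 0) ∉ cells A → IsRay g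
    ray 0∈ 1∈ -1∉ c∈A = along (connected A 0∈ c∈A) (0 , refl , λ { z≤n → 0∈ })
      where
      Reached : Cell → Set
      Reached c = ∃ λ n → c ≡ g · (+ n , + 0) × (∀ {m} → m ℕ.≤ n → g · (+ m , + 0) ∈ cells A)

      vertical : ∀ n → (∀ {m} → m ℕ.≤ n → g · (+ m , + 0) ∈ cells A) → ∀ {v} →
                 v ∈ₗ map (translate (+ n , + 0)) ((+ 0 , + 1) ∷ (+ 0 , -[1+ 0 ]) ∷ []) → g · v ∉ cells A
      -- At the end of the ray the horizontal arm of the corner is the cell to the right; elsewhere
      -- it is the already reached cell to the left.
      vertical zero below (here refl) =
        corner g (+ 0 , + 0) (+ 1 , + 0) (+ 0 , + 1) l₂-rightUp 0∈ 1∈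
      vertical zero below (there (here refl)) =
        corner g (+ 0 , + 0) (+ 1 , + 0) (+ 0 , -[1+ 0 ]) l₂-rightDown 0∈ 1∈
      vertical (suc n) below (here refl) =
        corner g (+ suc n , + 0) (-[1+ 0 ] , + 0) (+ 0 , + 1) l₂-leftUp
          (below ℕ.≤-refl) (below (ℕ.n≤1+n n))
      vertical (suc n) below (there (here refl)) =
        corner g (+ suc n , + 0) (-[1+ 0 ] , + 0) (+ 0 , -[1+ 0 ]) l₂-leftDown
          (below ℕ.≤-refl) (below (ℕ.n≤1+n n))

      next-cell : ∀ n {v} → (∀ {m} → m ℕ.≤ n → g · (+ m , + 0) ∈ cells A) → v ∈ cells A →
                  (∃ λ e → v ≡ g · e × e ∈ₗ neighbours (+ n , + 0)) → Reached v
      next-cell n below v∈A (_ , v≡ , here refl) =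
          suc n , v≡′ , λ m≤ → case ℕ.m≤n⇒m<n∨m≡n m≤ of λ where
            (inj₁ (s≤s m≤n)) → below m≤n
            (inj₂ refl)      → subst (_∈ cells A) v≡′ v∈A
        where v≡′ = trans v≡ (cong (λ k → g · (+ k , + 0)) (ℕ.+-comm n 1))
      next-cell zero    below v∈A (_ , refl , there (here refl)) = contradiction v∈A -1∉
      next-cell (suc n) below v∈A (_ , v≡ , there (here refl)) =
        n , v≡ , λ m≤n → below (ℕ.m≤n⇒m≤1+n m≤n)
      next-cell n below v∈A (_ , refl , there (there v∈)) = contradiction v∈A (vertical n below v∈)

      along : ∀ {c d} → Star (AdjacentIn (cells A)) c d → Reached c → Reached d
      along ε p = p
      along (_◅_ {j = v} (_ , v∈A , u~v) path) (n , u≡ , below) =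
        along path (next-cell n below v∈A (step-back g (+ n , + 0) v u≡ u~v))

-- Classification of the teams of size 3

Classified : Vector Polyomino 3 → Set
Classified F = F ≼ 𝒴₃ ⊎ 𝒩₃,₁ ≼ F ⊎ 𝒩₃,₂ ≼ F ⊎ 𝒩₃,₃ ≼ F ⊎ 𝒩₃,₄ ≼ F

module _ (em : ExcludedMiddle 0ℓ) where

  -- If no cell of `Q` lies outside the copy of the list, the inverse congruence embeds `Q`.
  -- Otherwise a path in `Q` to an outside cell leaves the copy, and the first cell beyond it is
  -- pulled back to the border.
  extend : ∀ {x xs} Q → (_∈ₗ x ∷ xs) ↪ cells Q →
           cells Q ↪ (_∈ₗ x ∷ xs) ⊎
           ∃ λ d → d ∈ₗ border (x ∷ xs) × (_∈ₗ d ∷ x ∷ xs) ↪ cells Q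
  extend {x} {xs} Q (g , X⊆Q) with em {∃ λ c → c ∈ cells Q × c ∉ₗ map (g ·_) (x ∷ xs)} | inverse g
  ... | no ∄c | h , h∘g = inj₁ (h , λ {c} c∈Q → case c ∈? map (g ·_) (x ∷ xs) of λ where
    (no c∉)  → contradiction (c , c∈Q , c∉) ∄c
    (yes c∈) → let d , d∈ , c≡ = ∈-map⁻ (g ·_) c∈ in
      subst (_∈ₗ x ∷ xs) (trans (sym (h∘g d)) (cong (h ·_) (sym c≡))) d∈)
  ... | yes (c , c∈Q , c∉) | h , h∘g
    with first-exit (_∈? map (g ·_) (x ∷ xs)) (connected Q (X⊆Q (here refl)) c∈Q) (here refl) c∉
  ... | u , v , u∈ , v∉ , v∈Q , u~v with ∈-map⁻ (g ·_) u∈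
  ... | d , d∈ , refl = inj₂ (h · v
    , ∈-border d∈ (subst (λ e → Adjacent e (h · v)) (h∘g d) (·-adjacent h (g · d) v u~v))
        (λ hv∈ → v∉ (subst (_∈ₗ _) gh (∈-map⁺ (g ·_) hv∈)))
    , g , λ { (here refl) → subst (_∈ cells Q) (sym gh) v∈Q ; (there e∈) → X⊆Q e∈ })
    where
    gh : g · (h · v) ≡ v
    gh = ·-injective h (h∘g (h · v))

  -- Unfolding the finite check below in a with-abstraction is prohibitively
  -- slow.
  abstract
    grow : ∀ x xs Ts {_ : True (extends? (x ∷ xs) Ts)} Q → (_∈ₗ x ∷ xs) ↪ cells Q →
           cells Q ↪ (_∈ₗ x ∷ xs) ⊎ Any (λ T → (_∈ₗ T) ↪ cells Q) Ts
    grow x xs Ts {ok} Q X↪Q = Sum.map₂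
      (λ (d , d∈ , dX↪Q) → Any.map
        (λ {T} T↪dX → ↪-trans {_∈ₗ T} {_∈ₗ d ∷ x ∷ xs} {cells Q} T↪dX dX↪Q)
        (All.lookup (toWitness ok) d∈))
      (extend Q X↪Q)

  module _ (A : Polyomino) (L₂-free : ¬ ((_∈ₗ l₂) ↪ cells A)) where
    open Straight A L₂-free

    -- The frame moves left one cell at a time, keeping its cells 0 and 1 in `A`, until the next
    -- cell to the left is missing. The known gap comes one closer with each move, so at most `n`
    -- moves are made.
    slide : ∀ n g → g · (+ 0 , + 0) ∈ cells A → g · (+ 1 , + 0) ∈ cells A →
            g · (-[1+ n ] , + 0) ∉ cells A → ∃ IsRay
    slide zero    g 0∈ 1∈ n∉ = g , ray g 0∈ 1∈ n∉
    slide (suc n) g 0∈ 1∈ n∉ with em {g · (-[1+ 0 ] , + 0) ∈ cells A}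
    ... | no -1∉ = g , ray g 0∈ 1∈ -1∉
    ... | yes -1∈ with compose g (moveTo (-[1+ 0 ] , + 0))
    ... | h , h≡ = slide n h
      (subst (_∈ cells A) (sym (h≡ (+ 0 , + 0))) -1∈)
      (subst (_∈ cells A) (sym (h≡ (+ 1 , + 0))) 0∈)
      (λ n∈ → n∉ (subst (_∈ cells A) (h≡ (-[1+ n ] , + 0)) n∈))

    line-or-ray : (_∈ₗ s₂) ↪ cells A → ∃ IsLine ⊎ ∃ IsRay
    line-or-ray (g , s₂⊆A) with em {∃ λ x → g · (x , + 0) ∉ cells A}
    ... | no ∄x = inj₁ (g , line g λ x → decidable-stable em λ x∉ → ∄x (x , x∉))
    ... | yes (+ 0 , 0∉)      = contradiction (s₂⊆A (here refl)) 0∉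
    ... | yes (+ 1 , 1∉)      = contradiction (s₂⊆A (there (here refl))) 1∉
    ... | yes (-[1+ n ] , n∉) = inj₂ (slide n g (s₂⊆A (here refl)) (s₂⊆A (there (here refl))) n∉)
    -- A gap on the right: the frame `x ↦ 1 - x` swaps the cells 0 and 1 and brings the gap from
    -- `n + 2` to `-(n + 1)`.
    ... | yes (+ suc (suc n) , n∉)
      with compose g (record { mirrored = true ; turns = zero ; shift = + 1 , + 0 })
    ... | h , h≡ = inj₂ (slide n h
      (subst (_∈ cells A) (sym (h≡ (+ 0 , + 0))) (s₂⊆A (there (here refl))))
      (subst (_∈ cells A) (sym (h≡ (+ 1 , + 0))) (s₂⊆A (here refl)))
      (λ n∈ → n∉ (subst (_∈ cells A) (h≡ (-[1+ n ] , + 0)) n∈)))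

  -- Straight polyominoes are ordered by length: a line contains every other, and of two rays laid
  -- on one axis from their ends, one is an initial piece of the other.
  L₂-free⇒comparable : ∀ A B → ¬ ((_∈ₗ l₂) ↪ cells A) → ¬ ((_∈ₗ l₂) ↪ cells B) →
                       (_∈ₗ s₂) ↪ cells A → (_∈ₗ s₂) ↪ cells B →
                       cells A ↪ cells B ⊎ cells B ↪ cells A
  L₂-free⇒comparable A B A-free B-free s₂↪A s₂↪B
    with line-or-ray A A-free s₂↪A | line-or-ray B B-free s₂↪B
  ... | inj₁ (g , full , _) | inj₁ (h , _ , on-line) =
    inj₂ (reframe (cells B) (cells A) h g λ c∈B →
      let x , c≡ = on-line c∈B in (x , + 0) , c≡ , full x)
  ... | inj₁ (g , full , _) | inj₂ (h , on-ray) =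
    inj₂ (reframe (cells B) (cells A) h g λ c∈B →
      let n , c≡ , _ = on-ray c∈B in (+ n , + 0) , c≡ , full (+ n))
  ... | inj₂ (g , on-ray) | inj₁ (h , full , _) =
    inj₁ (reframe (cells A) (cells B) g h λ c∈A →
      let n , c≡ , _ = on-ray c∈A in (+ n , + 0) , c≡ , full (+ n))
  ... | inj₂ (g , on-g) | inj₂ (h , on-h)
    with em {∃ λ n → g · (+ n , + 0) ∈ cells A × h · (+ n , + 0) ∉ cells B}
  ... | no ∄n = inj₁ (reframe (cells A) (cells B) g h λ c∈A →
    let n , c≡ , _ = on-g c∈A in (+ n , + 0) , c≡ ,
    decidable-stable em (λ n∉ → ∄n (n , subst (_∈ cells A) c≡ c∈A , n∉)))
  ... | yes (n , n∈A , n∉B) = inj₂ (reframe (cells B) (cells A) h g λ c∈B →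
    let m , c≡ , below = on-h c∈B in
    (+ m , + 0) , c≡ , ray-closed n∈A (ℕ.≮⇒≥ λ n<m → n∉B (below (ℕ.<⇒≤ n<m))))
    where
    ray-closed : g · (+ n , + 0) ∈ cells A → ∀ {m} → m ℕ.≤ n → g · (+ m , + 0) ∈ cells A
    ray-closed n∈A m≤n with on-g n∈A
    ... | k , n≡k , below with ·-injective g n≡k
    ... | refl = below m≤n

  contains-s₁ : ∀ Q → (_∈ₗ s₁) ↪ cells Q
  contains-s₁ Q with nonempty Q
  ... | c , c∈Q = moveTo c , λ { (here refl) → subst (_∈ cells Q) (sym (translate-identityʳ c)) c∈Q }

  module _ (F : Vector Polyomino 3) (team : IsTeam F) where

    -- Rules out the outcome of `grow` in which `F i` is a copy of `X`, as soon as another member is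
    -- known to contain `X`.
    antichain : ∀ {i j X} → i ≢ j → cells (F i) ↪ (_∈ₗ X) → ¬ ((_∈ₗ X) ↪ cells (F j))
    antichain {i} {j} {X} i≢j Fi↪X X↪Fj =
      team i j i≢j (↪-trans {cells (F i)} {_∈ₗ X} {cells (F j)} Fi↪X X↪Fj)

    another : (i : Fin 3) → ∃ λ j → i ≢ j
    another zero    = suc zero , λ ()
    another (suc i) = zero , λ ()

    contains-s₂ : ∀ i → (_∈ₗ s₂) ↪ cells (F i)
    contains-s₂ i with grow _ _ (s₂ ∷ []) (F i) (contains-s₁ (F i))
    ... | inj₁ Fi↪s₁       = let j , i≢j = another i in
      contradiction (contains-s₁ (F j)) (antichain i≢j Fi↪s₁)
    ... | inj₂ (here s₂↪Fi) = s₂↪Fi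

    contains-s₃∨l₂ : ∀ i → (_∈ₗ s₃) ↪ cells (F i) ⊎ (_∈ₗ l₂) ↪ cells (F i)
    contains-s₃∨l₂ i with grow _ _ (s₃ ∷ l₂ ∷ []) (F i) (contains-s₂ i)
    ... | inj₁ Fi↪s₂               = let j , i≢j = another i in
      contradiction (contains-s₂ j) (antichain i≢j Fi↪s₂)
    ... | inj₂ (here s₃↪Fi)         = inj₁ s₃↪Fi
    ... | inj₂ (there (here l₂↪Fi)) = inj₂ l₂↪Fi

    L₂-free-unique : ∀ {i j} → i ≢ j → ¬ ((_∈ₗ l₂) ↪ cells (F i)) → (_∈ₗ l₂) ↪ cells (F j)
    L₂-free-unique {i} {j} i≢j Fi-free = decidable-stable em λ Fj-free →
      [ team i j i≢j , team j i (i≢j ∘ sym) ]′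
        (L₂-free⇒comparable (F i) (F j) Fi-free Fj-free (contains-s₂ i) (contains-s₂ j))

    -- `a` witnesses the failure of `𝒩₃,₁ ≼ F` and `b` that of `𝒩₃,₂ ≼ F`; they differ because `a`,
    -- being straight, contains `S₃` and `b` does not.
    module _ {a b c} (a≢b : a ≢ b) (a≢c : a ≢ c) (b≢c : b ≢ c)
             (only : ∀ i → i ≡ a ⊎ i ≡ b ⊎ i ≡ c)
             (a-free : ¬ ((_∈ₗ l₂) ↪ cells (F a))) (s₃↪a : (_∈ₗ s₃) ↪ cells (F a))
             (b-s₃-free : ¬ ((_∈ₗ s₃) ↪ cells (F b))) (b-z₂-free : ¬ ((_∈ₗ z₂) ↪ cells (F b)))
             where

      cover : ∀ {n} {N : Vector Polyomino n} → (∃ λ i → N i ⊑ F a) → (∃ λ i → N i ⊑ F b) →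
              (∃ λ i → N i ⊑ F c) → N ≼ F
      cover p q r j with only j
      ... | inj₁ refl        = p
      ... | inj₂ (inj₁ refl) = q
      ... | inj₂ (inj₂ refl) = r

      l₂↪c : (_∈ₗ l₂) ↪ cells (F c)
      l₂↪c = L₂-free-unique a≢c a-free

      -- `b` contains `L₂` because `a` does not. Its growth to four cells can only give `C₂`, and
      -- every cell adjacent to `C₂` completes an `S₃`, so the growth stops there.
      b-is-c₂ : cells (F b) ↪ (_∈ₗ c₂) × (_∈ₗ c₂) ↪ cells (F b)
      b-is-c₂ with grow _ _ (s₃ ∷ c₂ ∷ z₂ ∷ []) (F b) (L₂-free-unique a≢b a-free)
      ... | inj₁ b↪l₂                           = contradiction l₂↪c (antichain b≢c b↪l₂)
      ... | inj₂ (here s₃↪b)                    = contradiction s₃↪b b-s₃-free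
      ... | inj₂ (there (there (here z₂↪b)))    = contradiction z₂↪b b-z₂-free
      ... | inj₂ (there (here c₂↪b)) with grow _ _ (s₃ ∷ []) (F b) c₂↪b
      ... | inj₁ b↪c₂        = b↪c₂ , c₂↪b
      ... | inj₂ (here s₃↪b) = contradiction s₃↪b b-s₃-free

      c-c₂-free : ¬ ((_∈ₗ c₂) ↪ cells (F c))
      c-c₂-free = antichain b≢c (proj₁ b-is-c₂)

      𝒩₃,₃≼ : (∃ λ i → 𝒩₃,₃ i ⊑ F c) → Classified F
      𝒩₃,₃≼ p = inj₂ (inj₂ (inj₂ (inj₁
        (cover {N = 𝒩₃,₃} (zero , s₃↪a) (suc zero , proj₂ b-is-c₂) p))))

      classify : Classified F
      classify with grow _ _ (s₃ ∷ c₂ ∷ z₂ ∷ []) (F c) l₂↪c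
      ... | inj₁ c↪l₂ = contradiction (L₂-free-unique a≢b a-free) (antichain (b≢c ∘ sym) c↪l₂)
      ... | inj₂ (here s₃↪c)         = 𝒩₃,₃≼ (zero , s₃↪c)
      ... | inj₂ (there (here c₂↪c)) = contradiction c₂↪c c-c₂-free
      ... | inj₂ (there (there (here z₂↪c))) with grow _ _ (s₃ ∷ c₂ ∷ p₅,₁₀ ∷ []) (F c) z₂↪c
      ... | inj₂ (here s₃↪c)                    = 𝒩₃,₃≼ (zero , s₃↪c)
      ... | inj₂ (there (here c₂↪c))            = contradiction c₂↪c c-c₂-free
      ... | inj₂ (there (there (here p₅,₁₀↪c))) = 𝒩₃,₃≼ (suc (suc zero) , p₅,₁₀↪c)
      -- Now `b` is `C₂` and `c` is `Z₂`, so only the length of the straight member `a` remains: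
      -- three cells, or at least four.
      ... | inj₁ c↪z₂ with grow _ _ (s₄ ∷ l₂ ∷ []) (F a) s₃↪a
      ... | inj₁ a↪s₃ = inj₁ λ where
        zero             → a , a↪s₃
        (suc zero)       → b , proj₁ b-is-c₂
        (suc (suc zero)) → c , c↪z₂
      ... | inj₂ (there (here l₂↪a)) = contradiction l₂↪a a-free
      ... | inj₂ (here s₄↪a)         = inj₂ (inj₂ (inj₂ (inj₂
        (cover {N = 𝒩₃,₄} (zero , s₄↪a) (suc zero , proj₂ b-is-c₂) (suc (suc zero) , z₂↪c)))))

    third : (a b : Fin 3) → a ≢ b →
            ∃ λ c → a ≢ c × b ≢ c × (∀ i → i ≡ a ⊎ i ≡ b ⊎ i ≡ c)
    third = from-yes (Fin.all? λ (a : Fin 3) → Fin.all? λ b → ¬? (a Fin.≟ b) →-dec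
      Fin.any? λ c → ¬? (a Fin.≟ c) ×-dec ¬? (b Fin.≟ c) ×-dec
        Fin.all? λ i → (i Fin.≟ a) ⊎-dec (i Fin.≟ b) ⊎-dec (i Fin.≟ c))

    classification : Classified F
    classification with em {𝒩₃,₁ ≼ F} | em {𝒩₃,₂ ≼ F}
    ... | yes p | _     = inj₂ (inj₁ p)
    ... | no _  | yes p = inj₂ (inj₂ (inj₁ p))
    ... | no ¬p | no ¬q
      with Fin.¬∀⟶∃¬ 3 _ (λ _ → em) ¬p | Fin.¬∀⟶∃¬ 3 _ (λ _ → em) ¬q
    ... | a , a-free | b , b-free = classify a≢b a≢c b≢c only a-l₂-free s₃↪a
        (λ s₃↪b → b-free (zero , s₃↪b)) (λ z₂↪b → b-free (suc zero , z₂↪b))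
      where
      a-l₂-free : ¬ ((_∈ₗ l₂) ↪ cells (F a))
      a-l₂-free l₂↪a = a-free (zero , l₂↪a)

      s₃↪a : (_∈ₗ s₃) ↪ cells (F a)
      s₃↪a = [ id , (λ l₂↪a → contradiction l₂↪a a-l₂-free) ]′ (contains-s₃∨l₂ a)

      a≢b : a ≢ b
      a≢b refl = b-free (zero , s₃↪a)

      rest : ∃ λ c → a ≢ c × b ≢ c × (∀ i → i ≡ a ⊎ i ≡ b ⊎ i ≡ c)
      rest = third a b a≢b

      a≢c  = proj₁ (proj₂ rest)
      b≢c  = proj₁ (proj₂ (proj₂ rest))
      only = proj₂ (proj₂ (proj₂ rest))

-- The maker

lookup-injective : ∀ {A : Set} {xs : List A} → Unique xs →
                   ∀ {i j} → List.lookup xs i ≡ List.lookup xs j → i ≡ j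
lookup-injective (_ ∷ _)      {zero}  {zero}  _  = refl
lookup-injective (x∉xs ∷ _)   {zero}  {suc j} eq = contradiction eq (All.lookup x∉xs (∈-lookup j))
lookup-injective (x∉xs ∷ _)   {suc i} {zero}  eq = contradiction (sym eq) (All.lookup x∉xs (∈-lookup i))
lookup-injective (_ ∷ unique) {suc i} {suc j} eq = cong suc (lookup-injective unique eq)

-- Pigeonhole: sending each entry of `xs` to its position in `ys` is injective.
unique-⊆⇒length≤ : ∀ {A : Set} {xs ys : List A} → Unique xs → All (_∈ₗ ys) xs →
                   length xs ℕ.≤ length ys
unique-⊆⇒length≤ {xs = xs} {ys} unique xs⊆ys = Fin.injective⇒≤ {f = position} injective
  where
  located : ∀ i → List.lookup xs i ∈ₗ ys
  located i = All.lookup xs⊆ys (∈-lookup i)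

  position : Fin (length xs) → Fin (length ys)
  position i = Any.index (located i)

  injective : ∀ {i j} → position i ≡ position j → i ≡ j
  injective {i} {j} eq = lookup-injective unique
    (trans (lookup-index (located i))
      (trans (cong (List.lookup ys) eq) (sym (lookup-index (located j)))))

outside : ∀ {cs xs} → Unique cs → length xs ℕ.< length cs → ∃ λ c → c ∈ₗ cs × c ∉ₗ xs
outside {cs} {xs} unique longer with any? (λ c → ¬? (c ∈? xs)) cs
... | yes found = find found
... | no ∄c     = contradiction
  (unique-⊆⇒length≤ unique (All.map (decidable-stable (_ ∈? xs)) (¬Any⇒All¬ cs ∄c)))
  (ℕ.<⇒≱ longer)

fresh : ∀ xs → ∃ λ c → c ∉ₗ xs
fresh xs =
  let c , _ , c∉ = outside {applyUpTo (λ i → + i , + 0) (suc (length xs))}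
        (applyUpTo⁺₁ (λ i → + i , + 0) (suc (length xs)) λ { i<j _ refl → ℕ.<-irrefl refl i<j })
        (ℕ.≤-reflexive (sym (length-applyUpTo (λ i → + i , + 0) (suc (length xs)))))
  in c , c∉

-- The fallback to an arbitrary free cell keeps the moves of both players legal when every preferred
-- cell is taken.
pick : ∀ cs xs → ∃ λ c → c ∉ₗ xs
pick cs xs with any? (λ c → ¬? (c ∈? xs)) cs
... | yes found = let c , _ , c∉ = find found in c , c∉
... | no _      = fresh xs

pick-∈ : ∀ cs xs {c} → c ∈ₗ cs → c ∉ₗ xs → proj₁ (pick cs xs) ∈ₗ cs
pick-∈ cs xs c∈ c∉ with any? (λ c → ¬? (c ∈? xs)) cs
... | yes found = proj₁ (proj₂ (find found))
... | no ∄c     = contradiction (lose c∈ c∉) ∄c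

makerMarks⊆marks : ∀ h {c} → c ∈ₗ makerMarks h → c ∈ₗ marks h
makerMarks⊆marks (_ ∷ _) (here refl) = there (there (here refl))
makerMarks⊆marks (_ ∷ h) (there c∈)  = there (there (there (makerMarks⊆marks h c∈)))

length-marks : ∀ h → length (marks h) ≡ 3 ℕ.* length (makerMarks h)
length-marks []      = refl
length-marks (_ ∷ h) = trans (cong (3 ℕ.+_) (length-marks h)) (sym (ℕ.*-suc 3 (length (makerMarks h))))

candidates : List Cell → List Cell
candidates []         = (+ 0 , + 0) ∷ []
candidates cs@(_ ∷ _) = border cs

grower : MakerStrategy
grower h = pick (candidates (makerMarks h)) (marks h)

-- If all adjacent cells were marked then, together with the maker's own cells,
-- they would be more than the three marks per round.
WinningIn : ∀ {n} → ℕ → (Fin n → List Cell) → List Cell → Set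
WinningIn zero    X cs = ∃ λ i → (_∈ₗ X i) ↪ (_∈ₗ cs)
WinningIn (suc k) X cs =
  (∃ λ i → (_∈ₗ X i) ↪ (_∈ₗ cs)) ⊎
  (Unique (candidates cs ++ cs) × 3 ℕ.* length cs ℕ.< length (candidates cs ++ cs)) ×
  All (λ c → WinningIn k X (c ∷ cs)) (candidates cs)

winningIn? : ∀ {n} k (X : Fin n → List Cell) cs → Dec (WinningIn k X cs)
winningIn? zero    X cs = Fin.any? λ i → embeds? (X i) cs
winningIn? (suc k) X cs =
  (Fin.any? λ i → embeds? (X i) cs) ⊎-dec
  (unique? (candidates cs ++ cs) ×-dec 3 ℕ.* length cs ℕ.<? length (candidates cs ++ cs)) ×-dec
  All.all? (λ c → winningIn? k X (c ∷ cs)) (candidates cs)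

members : ∀ {I : Set} (F : I → Polyomino) → Bounded F → I → List Cell
members F finite i = proj₁ (finite i)

module _ {n} (F : Fin n → Polyomino) (finite : Bounded F)
         (r : ℕ → Round) (follows : r Follows grower) where

  found : ∀ k → (∃ λ i → (_∈ₗ members F finite i) ↪ (_∈ₗ makerMarks (past r k))) → MakerWins F r
  found k (i , g , inside) = k , i , g , λ c∈ → inside (proj₁ (proj₂ (finite i)) c∈)

  in-candidates : ∀ k → let cs = makerMarks (past r k) in
                  Unique (candidates cs ++ cs) → 3 ℕ.* length cs ℕ.< length (candidates cs ++ cs) →
                  maker (r k) ∈ₗ candidates cs
  in-candidates k unique longer
    with outside unique
           (subst (ℕ._< length (candidates (makerMarks (past r k)) ++ makerMarks (past r k)))
             (sym (length-marks (past r k))) longer)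
  ... | c , c∈ , c∉ with ∈-++⁻ (candidates (makerMarks (past r k))) c∈
  ... | inj₁ c∈candidates = subst (_∈ₗ candidates (makerMarks (past r k))) (sym (follows k))
          (pick-∈ (candidates (makerMarks (past r k))) (marks (past r k)) c∈candidates c∉)
  ... | inj₂ c∈own = contradiction (makerMarks⊆marks (past r k) c∈own) c∉

  wins-from : ∀ k j → WinningIn j (members F finite) (makerMarks (past r k)) → MakerWins F r
  wins-from k zero    won        = found k won
  wins-from k (suc j) (inj₁ won) = found k won
  wins-from k (suc j) (inj₂ ((unique , longer) , replies)) =
    wins-from (suc k) j (All.lookup replies (in-candidates k unique longer))

maker-wins : ∀ {n} (F : Fin n → Polyomino) (finite : Bounded F) k →
             WinningIn k (members F finite) [] → HasWinningStrategy F
maker-wins F finite k winning = grower , λ r follows _ → wins-from F finite r follows 0 k winning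

bounded-𝒴₃ : Bounded 𝒴₃
bounded-𝒴₃ zero             = s₃ , id , id
bounded-𝒴₃ (suc zero)       = c₂ , id , id
bounded-𝒴₃ (suc (suc zero)) = z₂ , id , id

winning-𝒴₃ : HasWinningStrategy 𝒴₃
-- Four moves: by then the maker owns a connected set of four cells, if he has not won before.
winning-𝒴₃ = maker-wins 𝒴₃ bounded-𝒴₃ 4 (toWitness {a? = winningIn? 4 (members 𝒴₃ bounded-𝒴₃) []} _)

-- The breaker

-- Of two linked cells, the one marked first by the maker makes the breaker
-- take the other, so the maker never owns both.
module Pairing {I : Set} (F : I → Polyomino) (ρ₁ ρ₂ : Cell → Cell) where

  Answers Linked : Cell → Cell → Set
  Answers c d = d ∈ₗ ρ₁ c ∷ ρ₂ c ∷ []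
  Linked  c d = c ≢ d × Answers c d × Answers d c

  module _ (σ : MakerStrategy) where

    reply : History → Round
    reply h = round m b₁ b₂
      where
      m  = proj₁ (σ h)
      b₁ = proj₁ (pick (ρ₁ m ∷ []) (m ∷ marks h))
      b₂ = proj₁ (pick (ρ₂ m ∷ []) (b₁ ∷ m ∷ marks h))

    history : ℕ → History
    history zero    = []
    history (suc n) = reply (history n) ∷ history n

    play : ℕ → Round
    play n = reply (history n)

    past-play : ∀ n → past play n ≡ history n
    past-play zero    = refl
    past-play (suc n) = cong (play n ∷_) (past-play n)

    follows : play Follows σ
    follows n = cong (proj₁ ∘ σ) (sym (past-play n))

    legal : BreakerLegal play
    legal n = subst (λ h → b₁ ∉ₗ m ∷ marks h × b₂ ∉ₗ b₁ ∷ m ∷ marks h) (sym (past-play n))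
      (proj₂ (pick (ρ₁ m ∷ []) (m ∷ marks (history n))) ,
       proj₂ (pick (ρ₂ m ∷ []) (b₁ ∷ m ∷ marks (history n))))
      where
      m  = maker (play n)
      b₁ = breaker₁ (play n)
      b₂ = breaker₂ (play n)

    -- Either `c` was marked before, or `pick` has no other choice than `c`.
    taken : ∀ c xs → c ∈ₗ proj₁ (pick (c ∷ []) xs) ∷ xs
    taken c xs = case c ∈? xs of λ where
      (yes c∈) → there c∈
      (no c∉)  → case pick-∈ (c ∷ []) xs (here refl) c∉ of λ where
        (here eq) → here (sym eq)

    answered : ∀ n {c d} → c ∈ₗ makerMarks (history n) → Answers c d → d ∈ₗ marks (history n)
    answered (suc n) (here refl) (here refl)         = there (taken _ _)
    answered (suc n) (here refl) (there (here refl)) = taken _ _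
    answered (suc n) (there c∈)  ans                 = there (there (there (answered n c∈ ans)))

    unlinked : ∀ n {c d} → c ∈ₗ makerMarks (history n) → d ∈ₗ makerMarks (history n) → ¬ Linked c d
    unlinked (suc n) (here refl) (here refl) (c≢d , _) = c≢d refl
    unlinked (suc n) (here refl) (there d∈) (_ , _ , ans) =
      proj₂ (σ (history n)) (answered n d∈ ans)
    unlinked (suc n) (there c∈) (here refl) (_ , ans , _) =
      proj₂ (σ (history n)) (answered n c∈ ans)
    unlinked (suc n) (there c∈) (there d∈) = unlinked n c∈ d∈

  breaker-wins : (∀ g i → ∃ λ c → ∃ λ d →
                   c ∈ cells (F i) × d ∈ cells (F i) × Linked (g · c) (g · d)) →
                 ¬ HasWinningStrategy F
  breaker-wins paved (σ , wins) =
    let n , i , g , inside = wins (play σ) (follows σ) (legal σ)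
        c , d , c∈ , d∈ , linked = paved g i
        marked = λ {e} (e∈ : e ∈ cells (F i)) →
          subst (λ h → g · e ∈ₗ makerMarks h) (past-play σ n) (inside e∈)
    in unlinked σ n (marked c∈) (marked d∈) linked

-- Doubly periodic graphs

-- The difference of the remainders is a multiple of `k` but smaller than `k` in absolute value,
-- hence zero.
remainder-unique : ∀ {k r₁ r₂} p q → r₁ ℕ.< k → r₂ ℕ.< k →
                   + r₁ + p * + k ≡ + r₂ + q * + k → r₁ ≡ r₂
remainder-unique {k} {r₁} {r₂} p q r₁<k r₂<k eq = lemma ∣ q - p ∣ refl
  where
  open +-*-Solver

  difference : + r₁ - + r₂ ≡ (q - p) * + k
  difference = begin
    + r₁ - + r₂
      ≡⟨ solve 4 (λ a b p k → a :- b := (a :+ p :* k) :- b :- p :* k)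
           refl (+ r₁) (+ r₂) p (+ k) ⟩
    (+ r₁ + p * + k) - + r₂ - p * + k
      ≡⟨ cong (λ z → z - + r₂ - p * + k) eq ⟩
    (+ r₂ + q * + k) - + r₂ - p * + k
      ≡⟨ solve 4 (λ b p q k → (b :+ q :* k) :- b :- p :* k := (q :- p) :* k)
           refl (+ r₂) p q (+ k) ⟩
    (q - p) * + k ∎
    where open ≡-Reasoning

  lemma : ∀ m → ∣ q - p ∣ ≡ m → r₁ ≡ r₂
  lemma zero eq₀ = ℤ.+-injective (ℤ.i-j≡0⇒i≡j (+ r₁) (+ r₂)
    (trans difference (cong (_* + k) (ℤ.∣i∣≡0⇒i≡0 {q - p} eq₀))))
  lemma (suc m) eq₁ = contradiction (begin-strict
    k                    ≤⟨ ℕ.m≤m+n k (m ℕ.* k) ⟩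
    suc m ℕ.* k          ≡⟨ cong (ℕ._* k) eq₁ ⟨
    ∣ q - p ∣ ℕ.* k      ≡⟨ ℤ.abs-* (q - p) (+ k) ⟨
    ∣ (q - p) * + k ∣    ≡⟨ cong ∣_∣ difference ⟨
    ∣ + r₁ - + r₂ ∣      ≡⟨ cong ∣_∣ (ℤ.m-n≡m⊖n r₁ r₂) ⟩
    ∣ r₁ ℤ.⊖ r₂ ∣        ≤⟨ ℤ.∣m⊝n∣≤m⊔n r₁ r₂ ⟩
    r₁ ℕ.⊔ r₂            <⟨ ℕ.⊔-lub r₁<k r₂<k ⟩
    k                    ∎) (ℕ.<-irrefl refl)
    where open ℕ.≤-Reasoning

-- Both sides are remainders of `i + j`, with possibly different quotients. It makes a translation
-- act on residues of `form` only through its own residue.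
%ℕ-distribˡ-+ : ∀ i j k .{{_ : ℕ.NonZero k}} → (+ (i %ℕ k) + j) %ℕ k ≡ (i + j) %ℕ k
%ℕ-distribˡ-+ i j k =
  remainder-unique (q₁ + q) q₂ (n%ℕd<d (+ (i %ℕ k) + j) k) (n%ℕd<d (i + j) k) (begin
    + r₁ + (q₁ + q) * + k
      ≡⟨ solve 4 (λ a b c k → a :+ (b :+ c) :* k := (a :+ b :* k) :+ c :* k)
           refl (+ r₁) q₁ q (+ k) ⟩
    (+ r₁ + q₁ * + k) + q * + k
      ≡⟨ cong (_+ q * + k) (a≡a%ℕn+[a/ℕn]*n (+ (i %ℕ k) + j) k) ⟨
    (+ (i %ℕ k) + j) + q * + k
      ≡⟨ solve 3 (λ a b c → (a :+ b) :+ c := (a :+ c) :+ b) refl (+ (i %ℕ k)) j (q * + k) ⟩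
    (+ (i %ℕ k) + q * + k) + j
      ≡⟨ cong (_+ j) (a≡a%ℕn+[a/ℕn]*n i k) ⟨
    i + j
      ≡⟨ a≡a%ℕn+[a/ℕn]*n (i + j) k ⟩
    _ ∎)
  where
  open +-*-Solver
  open ≡-Reasoning
  r₁ = (+ (i %ℕ k) + j) %ℕ k
  q₁ = (+ (i %ℕ k) + j) /ℕ k
  q₂ = (i + j) /ℕ k
  q  = i /ℕ k

translate-assoc : ∀ s c d → translate (translate s c) d ≡ translate s (translate c d)
translate-assoc (a , b) (x , y) (z , w) = cong₂ _,_ (ℤ.+-assoc a x z) (ℤ.+-assoc b y w)

translate-injective : ∀ s {c d} → translate s c ≡ translate s d → c ≡ d
translate-injective s {c} {d} eq =
  trans (sym (translate-cancelˡ s c)) (trans (cong (translate (negate s)) eq) (translate-cancelˡ s d))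

-- The graph is invariant under all translations by vectors whose `form` is divisible by `k`.
module Periodic (k : ℕ) .{{_ : ℕ.NonZero k}} (slope : ℤ) (offsets : ℕ → Cell × Cell) where

  form : Cell → ℤ
  form (x , y) = x + slope * y

  ρ₁ ρ₂ : Cell → Cell
  ρ₁ c = translate c (proj₁ (offsets (form c %ℕ k)))
  ρ₂ c = translate c (proj₂ (offsets (form c %ℕ k)))

  -- `a` is the residue of the shift of a congruence. Nothing else about the shift matters, so
  -- `Paved` checks `k` residues and eight orientations instead of infinitely many placements.
  AnswersAt LinkedAt : ℕ → Cell → Cell → Set
  AnswersAt a c d = d ∈ₗ translate c (proj₁ o) ∷ translate c (proj₂ o) ∷ []
    where o = offsets ((+ a + form c) %ℕ k)
  LinkedAt a c d = c ≢ d × AnswersAt a c d × AnswersAt a d c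

  linkedAt? : ∀ a c d → Dec (LinkedAt a c d)
  linkedAt? a c d = ¬? (c ≟ d) ×-dec (_ ∈? _) ×-dec (_ ∈? _)

  Paved : ∀ {n} → (Fin n → List Cell) → Set
  Paved {n} X = ∀ i (a : Fin k) m t →
    Any (λ c → Any (λ d → LinkedAt (toℕ a) (orient m t c) (orient m t d)) (X i)) (X i)

  paved? : ∀ {n} (X : Fin n → List Cell) → Dec (Paved X)
  paved? {n} X = Fin.all? λ i → Fin.all? λ a → ∀Bool? λ m → Fin.all? λ t →
    any? (λ c → any? (λ d → linkedAt? (toℕ a) (orient m t c) (orient m t d)) (X i)) (X i)
    where
    ∀Bool? : {P : Bool → Set} → (∀ b → Dec (P b)) → Dec (∀ b → P b)
    ∀Bool? P? = map′ (λ { (p , q) false → p ; (p , q) true → q }) (λ p → p false , p true)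
      (P? false ×-dec P? true)

  form-translate : ∀ s c → (+ (form s %ℕ k) + form c) %ℕ k ≡ form (translate s c) %ℕ k
  form-translate s@(a , b) c@(x , y) = trans (%ℕ-distribˡ-+ (form s) (form c) k) (cong (_%ℕ k)
    (solve 5 (λ a b x y m → (a :+ m :* b) :+ (x :+ m :* y) := (a :+ x) :+ m :* (b :+ y))
      refl a b x y slope))
    where open +-*-Solver

  module _ {n} (F : Fin n → Polyomino) (finite : Bounded F) where
    open Pairing F ρ₁ ρ₂

    answersAt⇒answers : ∀ s c d → AnswersAt (form s %ℕ k) c d →
                        Answers (translate s c) (translate s d)
    answersAt⇒answers s c d answers = subst
      (λ a → translate s d ∈ₗ translate (translate s c) (proj₁ (offsets a)) ∷
                              translate (translate s c) (proj₂ (offsets a)) ∷ [])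
      (form-translate s c)
      (case answers of λ where
        (here d≡)         → here (shifted d≡)
        (there (here d≡)) → there (here (shifted d≡)))
      where
      shifted : ∀ {o} → d ≡ translate c o → translate s d ≡ translate (translate s c) o
      shifted {o} d≡ = trans (cong (translate s) d≡) (sym (translate-assoc s c o))

    loses : Paved (members F finite) → ¬ HasWinningStrategy F
    loses paved = breaker-wins λ g i →
      let open Congruence g
          s = shift
          c , c∈ , rest = find (at g i)
          d , d∈ , c≢d , c→d , d→c = find rest
      in c , d , proj₂ (proj₂ (finite i)) c∈ , proj₂ (proj₂ (finite i)) d∈ ,
         c≢d ∘ translate-injective s ,
         answersAt⇒answers s (orient mirrored turns c) (orient mirrored turns d) c→d ,
         answersAt⇒answers s (orient mirrored turns d) (orient mirrored turns c) d→c
      where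
      LinkedIn : Congruence → Fin n → ℕ → Set
      LinkedIn g i a = Any (λ c → Any (λ d →
          LinkedAt a (orient mirrored turns c) (orient mirrored turns d))
        (members F finite i)) (members F finite i)
        where open Congruence g

      at : ∀ g i → LinkedIn g i (form (Congruence.shift g) %ℕ k)
      at g i = subst (LinkedIn g i) (Fin.toℕ-fromℕ< residue<k) (paved i (fromℕ< residue<k) mirrored turns)
        where
        open Congruence g
        residue<k = n%ℕd<d (form shift) k

-- Graphs against the four losing teams

up down left right upRight downLeft : Cell
up        = + 0 , + 1
down      = + 0 , -[1+ 0 ]
left      = -[1+ 0 ] , + 0
right     = + 1 , + 0
upRight   = + 1 , + 1
downLeft  = -[1+ 0 ] , -[1+ 0 ]

-- The graphs for 𝒩₃,₁, …, 𝒩₃,₄.  The edges at a cell (x , y) depend on the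
-- residue of x + slope * y, with modulus and slope as in losing-𝒩₃,₁, …; the
-- last clause stands for the largest residue.
offsets₁ offsets₂ offsets₃ offsets₄ : ℕ → Cell × Cell

-- The rows as paths: every copy of `L₂` contains a horizontal pair.
offsets₁ _ = left , right

-- Vertical meanders of width 2 with the steps up, left, up, right.
offsets₂ 0 = up , left
offsets₂ 1 = up , right
offsets₂ 2 = down , left
offsets₂ _ = down , right

-- The 4-cycles on the blocks of a tiling by 2 by 2 squares, whose neighbouring columns are shifted
-- by one cell.
offsets₃ 0 = up , right
offsets₃ 1 = left , up
offsets₃ 2 = down , right
offsets₃ _ = down , left

-- `x + 2 * y` is `x - y` modulo 3: diagonals of residue 1 alternate with staircases of residues 0
-- and 2. Four cells in a row contain a staircase edge; three can avoid it.
offsets₄ 0 = up , left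
offsets₄ 1 = upRight , downLeft
offsets₄ _ = down , right

bounded-𝒩₃,₁ : Bounded 𝒩₃,₁
bounded-𝒩₃,₁ zero = l₂ , id , id

bounded-𝒩₃,₂ : Bounded 𝒩₃,₂
bounded-𝒩₃,₂ zero       = s₃ , id , id
bounded-𝒩₃,₂ (suc zero) = z₂ , id , id

bounded-𝒩₃,₃ : Bounded 𝒩₃,₃
bounded-𝒩₃,₃ zero             = s₃ , id , id
bounded-𝒩₃,₃ (suc zero)       = c₂ , id , id
bounded-𝒩₃,₃ (suc (suc zero)) = p₅,₁₀ , id , id

bounded-𝒩₃,₄ : Bounded 𝒩₃,₄
bounded-𝒩₃,₄ zero             = s₄ , id , id
bounded-𝒩₃,₄ (suc zero)       = c₂ , id , id
bounded-𝒩₃,₄ (suc (suc zero)) = z₂ , id , id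

losing-𝒩₃,₁ : ¬ HasWinningStrategy 𝒩₃,₁
losing-𝒩₃,₁ = loses 𝒩₃,₁ bounded-𝒩₃,₁ (toWitness {a? = paved? (members 𝒩₃,₁ bounded-𝒩₃,₁)} _)
  where open Periodic 1 (+ 0) offsets₁

losing-𝒩₃,₂ : ¬ HasWinningStrategy 𝒩₃,₂
losing-𝒩₃,₂ = loses 𝒩₃,₂ bounded-𝒩₃,₂ (toWitness {a? = paved? (members 𝒩₃,₂ bounded-𝒩₃,₂)} _)
  where open Periodic 4 (+ 2) offsets₂

losing-𝒩₃,₃ : ¬ HasWinningStrategy 𝒩₃,₃
losing-𝒩₃,₃ = loses 𝒩₃,₃ bounded-𝒩₃,₃ (toWitness {a? = paved? (members 𝒩₃,₃ bounded-𝒩₃,₃)} _)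
  where open Periodic 4 (+ 2) offsets₃

losing-𝒩₃,₄ : ¬ HasWinningStrategy 𝒩₃,₄
losing-𝒩₃,₄ = loses 𝒩₃,₄ bounded-𝒩₃,₄ (toWitness {a? = paved? (members 𝒩₃,₄ bounded-𝒩₃,₄)} _)
  where open Periodic 3 (+ 2) offsets₄

-- Teams, winners and losers

Incomparable : ∀ {n} → (Fin n → List Cell) → Set
Incomparable X = ∀ i j → i ≢ j → ¬ ((_∈ₗ X i) ↪ (_∈ₗ X j))

incomparable? : ∀ {n} (X : Fin n → List Cell) → Dec (Incomparable X)
incomparable? X = Fin.all? λ i → Fin.all? λ j →
  ¬? (i Fin.≟ j) →-dec ¬? (embeds? (X i) (X j))

isTeam : ∀ {n} (F : Fin n → Polyomino) (finite : Bounded F) →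
         {_ : True (incomparable? (members F finite))} → IsTeam F
isTeam F finite {ok} i j i≢j (g , Fi⊆Fj) = toWitness ok i j i≢j
  (g , λ c∈ → proj₁ (proj₂ (finite j)) (Fi⊆Fj (proj₂ (proj₂ (finite i)) c∈)))

↪-refl : ∀ (A : Pred Cell 0ℓ) → A ↪ A
↪-refl A = let e , e≡ = identity in e , λ {c} c∈A → subst A (sym (e≡ c)) c∈A

simpler-wins : ∀ {I J : Set} (F : I → Polyomino) (G : J → Polyomino) →
               F ≼ G → HasWinningStrategy G → HasWinningStrategy F
simpler-wins F G F≼G (σ , wins) = σ , λ r follows legal →
  let k , j , Gj↪ = wins r follows legal
      i , Fi⊑Gj   = F≼G j
  in k , i , ↪-trans {cells (F i)} {cells (G j)} {_∈ₗ makerMarks (past r k)} Fi⊑Gj Gj↪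

-- For unbounded `F`, the members of `N` below those of `F` form a bounded restriction `G` of `F`;
-- were `F` a winner, `G` and hence the simpler `N` would have a winning strategy.
loser-above : ∀ {I J : Set} (N : I → Polyomino) (F : J → Polyomino) → Bounded N →
       ¬ HasWinningStrategy N → N ≼ F → Loser F
loser-above N F finite losing N≼F (bounded _ wins)   = losing (simpler-wins N F N≼F wins)
loser-above N F finite losing N≼F (unbounded _ wins) = losing (simpler-wins N G
  (λ j → proj₁ (N≼F j) , ↪-refl (cells (G j)))
  (wins G λ j → finite (proj₁ (N≼F j)) , proj₂ (N≼F j)))
  where
  G : _ → Polyomino
  G j = N (proj₁ (N≼F j))

≼-refl : ∀ {I : Set} (F : I → Polyomino) → F ≼ F
≼-refl F i = i , ↪-refl (cells (F i))

-- If `F` has an infinite member, each bounded restriction of `F` is still simpler than `Y`, since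
-- ancestors of ancestors are ancestors.
simpler⇒winner : ExcludedMiddle 0ℓ → ∀ {m n} (F : Vector Polyomino n) (Y : Vector Polyomino m) →
                 HasWinningStrategy Y → F ≼ Y → Winner F
simpler⇒winner em {n = n} F Y wins F≼Y with Fin.all? (λ i → em {Finite (F i)})
... | yes finite = bounded finite (simpler-wins F Y F≼Y wins)
... | no ¬finite = unbounded (Fin.¬∀⟶∃¬ n _ (λ _ → em) ¬finite) λ G restricts →
  simpler-wins G Y
    (λ j → let i , Fi⊑Yj = F≼Y j in
      i , ↪-trans {cells (G i)} {cells (F i)} {cells (Y j)} (proj₂ (restricts i)) Fi⊑Yj)
    wins

winner⇒simpler : ∀ (F : Vector Polyomino 3) → Classified F → Winner F → F ≼ 𝒴₃
winner⇒simpler F (inj₁ F≼𝒴₃) _ = F≼𝒴₃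
winner⇒simpler F (inj₂ (inj₁ N≼F)) winner =
  contradiction winner (loser-above 𝒩₃,₁ F bounded-𝒩₃,₁ losing-𝒩₃,₁ N≼F)
winner⇒simpler F (inj₂ (inj₂ (inj₁ N≼F))) winner =
  contradiction winner (loser-above 𝒩₃,₂ F bounded-𝒩₃,₂ losing-𝒩₃,₂ N≼F)
winner⇒simpler F (inj₂ (inj₂ (inj₂ (inj₁ N≼F)))) winner =
  contradiction winner (loser-above 𝒩₃,₃ F bounded-𝒩₃,₃ losing-𝒩₃,₃ N≼F)
winner⇒simpler F (inj₂ (inj₂ (inj₂ (inj₂ N≼F)))) winner =
  contradiction winner (loser-above 𝒩₃,₄ F bounded-𝒩₃,₄ losing-𝒩₃,₄ N≼F)

proposition6p4 : (IsTeam 𝒴₃ × Winner 𝒴₃)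
    × (IsTeam 𝒩₃,₁ × Loser 𝒩₃,₁)
    × (IsTeam 𝒩₃,₂ × Loser 𝒩₃,₂)
    × (IsTeam 𝒩₃,₃ × Loser 𝒩₃,₃)
    × (IsTeam 𝒩₃,₄ × Loser 𝒩₃,₄)
    × (ExcludedMiddle 0ℓ → (F : Vector Polyomino 3) → IsTeam F →
    (F ≼ 𝒴₃ ⊎ 𝒩₃,₁ ≼ F ⊎ 𝒩₃,₂ ≼ F ⊎ 𝒩₃,₃ ≼ F ⊎ 𝒩₃,₄ ≼ F)
    × (Winner F ⇔ F ≼ 𝒴₃))
proposition6p4 =
    (isTeam 𝒴₃ bounded-𝒴₃ , bounded bounded-𝒴₃ winning-𝒴₃)
  , loser 𝒩₃,₁ bounded-𝒩₃,₁ losing-𝒩₃,₁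
  , loser 𝒩₃,₂ bounded-𝒩₃,₂ losing-𝒩₃,₂
  , loser 𝒩₃,₃ bounded-𝒩₃,₃ losing-𝒩₃,₃
  , loser 𝒩₃,₄ bounded-𝒩₃,₄ losing-𝒩₃,₄
  , λ em F team → let classified = classification em F team in
      classified , mk⇔ (winner⇒simpler F classified) (simpler⇒winner em F 𝒴₃ winning-𝒴₃)
  where
  loser : ∀ {n} (N : Fin n → Polyomino) (finite : Bounded N)
          {_ : True (incomparable? (members N finite))} →
          ¬ HasWinningStrategy N → IsTeam N × Loser N
  loser N finite {ok} losing = isTeam N finite {ok} , loser-above N N finite losing (≼-refl N)
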